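{- Let $X$ be a self-similar graph with respect to $F$ and $\psi$ satisfying Axiom (S1) (stated in the context). Then $X$ is bipartite if and only if some cell graph is bipartite. Furthermore, $\theta=2$ if $X$ is bipartite.
   Context: Graphs $X=(VX,EX)$ are undirected, without loops or multiple edges. The boundary $\theta C$ of $C\subset VX$ is the set of vertices in $VX\setminus C$ which are adjacent to some vertex in $C$, and $\hat C$ denotes the subgraph of $X$ spanned by $C\cup\theta C$. For $F\subset VX$ let $\mathcal C_X(F)$ be the set of connected components of $VX\setminus F$. The reduced graph $X_F$ has vertex set $VX_F=F$, and two vertices $x,y\in F$ are joined by an edge of $X_F$ if and only if there is a component $C\in\mathcal C_X(F)$ such that $x,y\in\theta C$. A connected infinite graph $X$ is self-similar with respect to $F\subset VX$ and $\psi:VX\to VX_F$ if (F1) no vertices in $F$ are adjacent in $X$; (F2) the intersection of the boundaries of two different components in $\mathcal C_X(F)$ contains not more than one vertex; (F3) $\psi$ is an isomorphism between $X$ and $X_F$. The components in $\mathcal C_X(F)$ are called cells, and for a cell $C$ the graph $\hat C$ is called its cell graph. Axiom (S1): all cells are finite, and for any pair of cells $C,D\in\mathcal C_X(F)$ there exists an isomorphism $\alpha$ of $\hat C$ and $\hat D$ such that $\alpha(\theta C)=\theta D$. Under (S1), $\theta$ (as a number) denotes the number of vertices in the boundary of a cell, which is independent of the choice of the cell. -}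

module Defs where

open import Level using (Level; suc)
open import Data.Bool using (Bool)
open import Data.Fin using (Fin)
open import Data.Nat using (ℕ)
open import Data.Product using (Σ; ∃; _×_; _,_; proj₁; proj₂)
open import Data.Sum using (_⊎_; inj₁; inj₂)
open import Function using (_∘_)
open import Function.Bundles using (Bijection; Func; _⇔_)
open import Function.Structures using (IsBijection)
open import Relation.Binary.Bundles using (Setoid)
open import Relation.Binary.Core using (Rel)
open import Relation.Binary.Definitions using (Symmetric; Irreflexive; _Respects_; _Respects₂_)
open import Relation.Binary.PropositionalEquality using (_≢_; setoid)
open import Relation.Nullary using (¬_)
open import Relation.Unary using (Pred; _≐_)
import Relation.Binary.Construct.On as On

private
  variable
    ℓ : Level

------------------------------------------------------------------------
-- Subsets of setoids

record Subset (S : Setoid ℓ ℓ) : Set (suc ℓ) where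
  open Setoid S
  field
    Mem  : Pred Carrier ℓ
    resp : Mem Respects _≈_

open Subset public

infix 4 _∈_ _∉_

_∈_ _∉_ : {S : Setoid ℓ ℓ} → Setoid.Carrier S → Subset S → Set ℓ
x ∈ A = Mem A x
x ∉ A = ¬ (x ∈ A)

complement : {S : Setoid ℓ ℓ} → Subset S → Subset S
complement {S = S} A = record
  { Mem  = λ x → x ∉ A
  ; resp = λ x≈y x∉A y∈A → x∉A (resp A (Setoid.sym S x≈y) y∈A)
  }

infixr 6 _∪_

_∪_ : {S : Setoid ℓ ℓ} → Subset S → Subset S → Subset S
A ∪ B = record
  { Mem  = λ x → x ∈ A ⊎ x ∈ B
  ; resp = λ { x≈y (inj₁ x∈A) → inj₁ (resp A x≈y x∈A)
             ; x≈y (inj₂ x∈B) → inj₂ (resp B x≈y x∈B) }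
  }

-- Elements of a subset are compared in the ambient setoid, so different
-- proofs of membership do not give different elements.
elements : {S : Setoid ℓ ℓ} → Subset S → Setoid ℓ ℓ
elements {S = S} A = On.setoid S (proj₁ {B = Mem A})

HasSize : Setoid ℓ ℓ → ℕ → Set ℓ
HasSize S n = Bijection (setoid (Fin n)) S

Finite : Setoid ℓ ℓ → Set ℓ
Finite S = ∃ λ n → HasSize S n

------------------------------------------------------------------------
-- Graphs: undirected, without loops or multiple edges

record Graph (ℓ : Level) : Set (suc ℓ) where
  infix 4 _~_
  field
    vertices : Setoid ℓ ℓ
  open Setoid vertices public using (_≈_) renaming (Carrier to Vertex)
  field
    _~_      : Rel Vertex ℓ
    ~-resp   : _~_ Respects₂ _≈_
    ~-sym    : Symmetric _~_
    ~-irrefl : Irreflexive _≈_ _~_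

open Graph public using (vertices; Vertex)

VertexSet : Graph ℓ → Set (suc ℓ)
VertexSet G = Subset (vertices G)

Infinite : Graph ℓ → Set ℓ
Infinite G = ¬ Finite (vertices G)

module _ (G : Graph ℓ) where
  open Graph G using (_≈_; _~_)

  infixr 5 _∷_

  data Walk : Vertex G → Vertex G → Set ℓ where
    [_] : ∀ {x y} → x ≈ y → Walk x y
    _∷_ : ∀ {x y z} → x ~ y → Walk y z → Walk x z

  Connected : Set ℓ
  Connected = ∀ x y → Walk x y

  Bipartite : Set ℓ
  Bipartite = Σ (Func (vertices G) (setoid Bool)) λ colour →
    ∀ {x y} → x ~ y → Func.to colour x ≢ Func.to colour y

  Walk-respʳ : ∀ {x y z} → y ≈ z → Walk x y → Walk x z
  Walk-respʳ y≈z [ x≈y ]   = [ Setoid.trans (vertices G) x≈y y≈z ]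
  Walk-respʳ y≈z (e ∷ w)   = e ∷ Walk-respʳ y≈z w

spanned : (G : Graph ℓ) → VertexSet G → Graph ℓ
spanned G A = record
  { vertices = elements A
  ; _~_      = λ x y → proj₁ x ~ proj₁ y
  ; ~-resp   = (λ y≈z → proj₁ ~-resp y≈z) , (λ y≈z → proj₂ ~-resp y≈z)
  ; ~-sym    = ~-sym
  ; ~-irrefl = ~-irrefl
  } where open Graph G

record IsIsomorphism (G H : Graph ℓ) (f : Vertex G → Vertex H) : Set ℓ where
  private
    module G = Graph G
    module H = Graph H
  field
    isBijection : IsBijection G._≈_ H._≈_ f
    adjacency   : ∀ {x y} → (x G.~ y) ⇔ (f x H.~ f y)

boundary : (G : Graph ℓ) → VertexSet G → VertexSet G
boundary G C = record
  { Mem  = λ x → x ∉ C × ∃ λ y → y ∈ C × x ~ y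
  ; resp = λ { x≈z (x∉C , y , y∈C , x~y) →
               resp (complement C) x≈z x∉C , y , y∈C , proj₂ ~-resp x≈z x~y }
  } where open Graph G

------------------------------------------------------------------------
-- Cells and the reduced graph

module _ (X : Graph ℓ) (F : VertexSet X) where
  open Graph X using (_≈_; _~_)

  outside : Graph ℓ
  outside = spanned X (complement F)

  -- A component of VX ∖ F is given by any one of its vertices c; two
  -- vertices may name the same component.
  cell : Vertex outside → VertexSet X
  cell c = record
    { Mem  = λ x → Σ (x ∉ F) λ x∉F → Walk outside c (x , x∉F)
    ; resp = λ { x≈y (x∉F , w) →
                 resp (complement F) x≈y x∉F , Walk-respʳ outside x≈y w }
    }

  θ : Vertex outside → VertexSet X
  θ c = boundary X (cell c)

  cellGraph : Vertex outside → Graph ℓ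
  cellGraph c = spanned X (cell c ∪ θ c)

  reducedGraph : Graph ℓ
  reducedGraph = record
    { vertices = elements F
    ; _~_      = λ x y → ¬ (proj₁ x ≈ proj₁ y) ×
                         ∃ λ c → proj₁ x ∈ θ c × proj₁ y ∈ θ c
    ; ~-resp   = (λ { y≈z (x≉y , c , x∈θ , y∈θ) →
                      (λ x≈z → x≉y (trans x≈z (sym y≈z))) ,
                      c , x∈θ , resp (θ c) y≈z y∈θ })
               , (λ { x≈z (x≉y , c , x∈θ , y∈θ) →
                      (λ z≈y → x≉y (trans x≈z z≈y)) ,
                      c , resp (θ c) x≈z x∈θ , y∈θ })
    ; ~-sym    = λ { (x≉y , c , x∈θ , y∈θ) → (x≉y ∘ sym) , c , y∈θ , x∈θ }
    ; ~-irrefl = λ { x≈y (x≉y , _) → x≉y x≈y }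
    } where open Setoid (vertices X) using (sym; trans)

  SameCell : Rel (Vertex outside) ℓ
  SameCell c d = Mem (cell c) ≐ Mem (cell d)

  record SelfSimilar (ψ : Vertex X → Vertex reducedGraph) : Set ℓ where
    field
      connected : Connected X
      infinite  : Infinite X
      F1 : ∀ {x y} → x ∈ F → y ∈ F → ¬ (x ~ y)
      F2 : ∀ c d → ¬ SameCell c d →
           ∀ {x y} → x ∈ θ c → x ∈ θ d → y ∈ θ c → y ∈ θ d → x ≈ y
      F3 : IsIsomorphism X reducedGraph ψ

  MapsOntoBoundary : ∀ c d → (Vertex (cellGraph c) → Vertex (cellGraph d)) → Set ℓ
  MapsOntoBoundary c d α =
    (λ y → ∃ λ x → proj₁ x ∈ θ c × proj₁ (α x) ≈ y) ≐ Mem (θ d)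

  record S1 : Set ℓ where
    field
      cells-finite     : ∀ c → Finite (elements (cell c))
      cells-isomorphic : ∀ c d →
        Σ (Vertex (cellGraph c) → Vertex (cellGraph d)) λ α →
          IsIsomorphism (cellGraph c) (cellGraph d) α ×
          MapsOntoBoundary c d α

  -- The statement "θ = n" about the common number of boundary vertices.
  BoundarySize : ℕ → Set ℓ
  BoundarySize n = ∀ c → HasSize (elements (θ c)) n

{-# OPTIONS --safe #-}

-- A triangle of X meets F in at most one vertex, so it lies in a cell graph.
-- Three boundary vertices of a cell form a triangle of X_F, hence yield one of
-- X; so θ ≤ 2 as soon as X, or a cell graph, is bipartite.  Also θ ≥ 2, since
-- X_F has an edge.
--
-- If the cell graphs are bipartite, any two distinct boundary vertices of a cell
-- have the same colour difference p, and p is the same for all cells.  A closed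
-- walk of length n through F splits at F into segments inside cell graphs;
-- replacing each segment by at most one edge of X_F and pulling back along ψ
-- gives a closed walk of X of length m ≤ n / 2 with n ≡ p m modulo 2.
-- By descent all closed walks of X are even.

module Submission where

open import Defs
open import Level using (Level)
open import Axiom.ExcludedMiddle using (ExcludedMiddle)
open import Data.Bool using (Bool; true; false; not; _xor_; _∧_)
open import Data.Bool.Properties
  using (¬-not; not-¬; not-involutive; not-distribˡ-xor; xor-same; ∧-zeroʳ)
  renaming (_≟_ to _≟ᵇ_)
open import Data.Empty using (⊥; ⊥-elim)
open import Data.Fin using (Fin; zero; suc)
open import Data.Nat using (ℕ; zero; suc; _+_; _*_; _≤_; _<_; z≤n; s≤s)
open import Data.Nat.Induction using (<-rec)
open import Data.Nat.Properties
  using (+-comm; ≤-trans; ≤-reflexive; m≤n+m; m≤m+n; *-suc; +-mono-≤; +-monoʳ-≤)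
open import Data.Product using (Σ; ∃; _×_; _,_; proj₁; proj₂)
open import Data.Sum using (_⊎_; inj₁; inj₂)
open import Function.Bundles using (Func; _⇔_; Equivalence; mk⇔)
open import Function.Structures using (IsBijection)
open import Relation.Binary.Bundles using (Setoid)
open import Relation.Binary.PropositionalEquality
  using (_≡_; _≢_; refl; sym; trans; cong; cong₂; subst; module ≡-Reasoning)
open import Relation.Nullary using (¬_; yes; no)

-- Parity and Boolean arithmetic

parity : ℕ → Bool
parity zero    = false
parity (suc n) = not (parity n)

parity-+ : ∀ m n → parity (m + n) ≡ parity m xor parity n
parity-+ zero    n = refl
parity-+ (suc m) n = trans (cong not (parity-+ m n)) (not-distribˡ-xor (parity m) (parity n))

xor≡false⇒≡ : ∀ a b → a xor b ≡ false → a ≡ b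
xor≡false⇒≡ false false _ = refl
xor≡false⇒≡ true  true  _ = refl

xor-telescope : ∀ a b c → (a xor b) xor (b xor c) ≡ a xor c
xor-telescope false false c     = refl
xor-telescope false true  false = refl
xor-telescope false true  true  = refl
xor-telescope true  false c     = refl
xor-telescope true  true  c     = refl

≢⇒xor≡true : ∀ {a b} → a ≢ b → a xor b ≡ true
≢⇒xor≡true {false} {false} a≢b = ⊥-elim (a≢b refl)
≢⇒xor≡true {false} {true}  _   = refl
≢⇒xor≡true {true}  {false} _   = refl
≢⇒xor≡true {true}  {true}  a≢b = ⊥-elim (a≢b refl)

no-three-colours : ∀ {a b c : Bool} → a ≢ b → b ≢ c → a ≢ c → ⊥
no-three-colours a≢b b≢c a≢c =
  a≢c (trans (¬-not a≢b) (trans (cong not (¬-not b≢c)) (not-involutive _)))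

-- Over the field with two elements this reads a + ab = a(1 + b). It accounts for one new edge in
-- front of a reduced walk.
xor-∧-not : ∀ a b → a xor (a ∧ b) ≡ a ∧ not b
xor-∧-not false _ = refl
xor-∧-not true  _ = refl

-- Supplies the strict decrease of the descent: halving a positive length gives a smaller one.
2*k≤1+n⇒k≤n : ∀ k {n} → 2 * k ≤ suc n → k ≤ n
2*k≤1+n⇒k≤n zero    _         = z≤n
2*k≤1+n⇒k≤n (suc k) (s≤s le) = ≤-trans (≤-trans (m≤n+m (suc k) k) (+-monoʳ-≤ k (m≤m+n (suc k) 0))) le

-- Walks, bipartite graphs and triangles

module _ {ℓ : Level} (G : Graph ℓ) where
  open Graph G using (_≈_; _~_; ~-resp)
  open Setoid (vertices G) using () renaming (trans to ≈-trans; sym to ≈-sym)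

  length : ∀ {x y} → Walk G x y → ℕ
  length [ _ ]   = 0
  length (_ ∷ w) = suc (length w)

  Walk-respˡ : ∀ {x y z} → x ≈ y → Walk G y z → Walk G x z
  Walk-respˡ x≈y [ y≈z ] = [ ≈-trans x≈y y≈z ]
  Walk-respˡ x≈y (e ∷ w) = proj₂ ~-resp (≈-sym x≈y) e ∷ w

  length-respˡ : ∀ {x y z} (x≈y : x ≈ y) (w : Walk G y z) → length (Walk-respˡ x≈y w) ≡ length w
  length-respˡ _ [ _ ]   = refl
  length-respˡ _ (_ ∷ _) = refl

  infixr 5 _++_

  _++_ : ∀ {x y z} → Walk G x y → Walk G y z → Walk G x z
  [ x≈y ] ++ w′ = Walk-respˡ x≈y w′
  (e ∷ w) ++ w′ = e ∷ (w ++ w′)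

  length-++ : ∀ {x y z} (w : Walk G x y) (w′ : Walk G y z) → length (w ++ w′) ≡ length w + length w′
  length-++ [ x≈y ] w′ = length-respˡ x≈y w′
  length-++ (_ ∷ w) w′ = cong suc (length-++ w w′)

  EvenClosedWalks : Set ℓ
  EvenClosedWalks = ∀ {x} (w : Walk G x x) → parity (length w) ≡ false

  -- Each vertex is coloured by the parity of the walk from `o` that connectedness provides.
  evenClosedWalks⇒bipartite : Connected G → Vertex G → EvenClosedWalks → Bipartite G
  evenClosedWalks⇒bipartite walk o even = record { to = colour ; cong = colour-cong } , proper
    where
    colour : Vertex G → Bool
    colour x = parity (length (walk o x))

    -- The walk from `o` to `x`, then `w`, then the walk from `y` back to `o` is closed, hence even.
    -- Applied to trivial and one-edge walks, this yields both properties of the colouring.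
    closes : ∀ {x y} (w : Walk G x y) →
             colour x ≡ parity (length w + length (walk y o))
    closes {x} {y} w = xor≡false⇒≡ _ _ (begin
      colour x xor parity (length w + length (walk y o))
        ≡⟨ parity-+ (length (walk o x)) _ ⟨
      parity (length (walk o x) + (length w + length (walk y o)))
        ≡⟨ cong (λ k → parity (length (walk o x) + k)) (length-++ w (walk y o)) ⟨
      parity (length (walk o x) + length (w ++ walk y o))
        ≡⟨ cong parity (length-++ (walk o x) (w ++ walk y o)) ⟨
      parity (length (walk o x ++ w ++ walk y o))
        ≡⟨ even (walk o x ++ w ++ walk y o) ⟩
      false ∎)
      where open ≡-Reasoning

    ≈-refl : ∀ {x} → x ≈ x
    ≈-refl = Setoid.refl (vertices G)

    colour-cong : ∀ {x y} → x ≈ y → colour x ≡ colour y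
    colour-cong x≈y = trans (closes [ x≈y ]) (sym (closes [ ≈-refl ]))

    proper : ∀ {x y} → x ~ y → colour x ≢ colour y
    proper x~y same = not-¬ (closes [ ≈-refl ]) (trans (sym same) (closes (x~y ∷ [ ≈-refl ])))

  bipartite⇒no-triangle : Bipartite G → ∀ {x y z} → x ~ y → y ~ z → x ~ z → ⊥
  bipartite⇒no-triangle (_ , proper) x~y y~z x~z =
    no-three-colours (proper x~y) (proper y~z) (proper x~z)

spanned-bipartite : {ℓ : Level} (G : Graph ℓ) (A : VertexSet G) → Bipartite G → Bipartite (spanned G A)
spanned-bipartite G A (colour , proper) =
  record { to = λ x → to (proj₁ x) ; cong = Func.cong colour } , proper
  where open Func colour using (to)

iso-bipartite : {ℓ : Level} (G H : Graph ℓ) (f : Vertex G → Vertex H) →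
                IsIsomorphism G H f → Bipartite H → Bipartite G
iso-bipartite G H f iso (colour , proper) =
  record { to = λ x → Func.to colour (f x)
         ; cong = λ x≈y → Func.cong colour (IsBijection.cong isBijection x≈y) } ,
  λ x~y → proper (Equivalence.to adjacency x~y)
  where open IsIsomorphism iso

-- In a graph without edges all walks are trivial, so a connected one has at most one vertex and is
-- finite.
edge-exists : {ℓ : Level} → ExcludedMiddle ℓ → (G : Graph ℓ) → Connected G → Infinite G →
              ∃ λ x → ∃ λ y → Graph._~_ G x y
edge-exists em G walk infinite with em {P = ∃ λ x → ∃ λ y → Graph._~_ G x y}
... | yes edge = edge
... | no edgeless with em {P = Vertex G}
...   | yes o = ⊥-elim (infinite (1 , record
          { to        = λ _ → o
          ; cong      = λ _ → Setoid.refl (vertices G)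
          ; bijective = (λ { {zero} {zero} _ → refl })
                      , λ x → zero , λ _ → single (walk o x) }))
  where
  single : ∀ {x y} → Walk G x y → Graph._≈_ G x y
  single [ x≈y ] = x≈y
  single (e ∷ _) = ⊥-elim (edgeless (_ , _ , e))
...   | no empty = ⊥-elim (infinite (0 , record
          { to        = λ ()
          ; cong      = λ { {()} }
          ; bijective = (λ { {()} }) , λ x → ⊥-elim (empty x) }))

-- Cells and their boundaries

module _ {ℓ : Level} (em : ExcludedMiddle ℓ) (X : Graph ℓ) (F : VertexSet X) where
  open Graph X using (_≈_; _~_; ~-sym; ~-resp)
  open Setoid (vertices X) using () renaming (refl to ≈-refl; trans to ≈-trans; sym to ≈-sym)

  self∈cell : ∀ c → proj₁ c ∈ cell X F c
  self∈cell c = proj₂ c , [ ≈-refl ]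

  cell-closed : ∀ {c x y} → x ∈ cell X F c → x ~ y → y ∉ F → y ∈ cell X F c
  cell-closed (x∉F , w) x~y y∉F =
    y∉F , _++_ (outside X F) {y = _ , x∉F} w (_∷_ {y = _ , y∉F} x~y [ ≈-refl ])

  F-neighbour∈θ : ∀ {c x y} → x ∈ cell X F c → x ~ y → y ∈ F → y ∈ θ X F c
  F-neighbour∈θ x∈c x~y y∈F = (λ y∈c → proj₁ y∈c y∈F) , _ , x∈c , ~-sym x~y

  -- A neighbour of a cell that lies outside `F` belongs to that cell.
  θ⊆F : ∀ {c x} → x ∈ θ X F c → x ∈ F
  θ⊆F {x = x} (x∉c , y , y∈c , x~y) with em {P = x ∈ F}
  ... | yes x∈F = x∈F
  ... | no x∉F  = ⊥-elim (x∉c (cell-closed y∈c (~-sym x~y) x∉F))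

  neighbour∈cellGraph : ∀ {c x y} → x ∈ cell X F c → x ~ y → y ∈ cell X F c ∪ θ X F c
  neighbour∈cellGraph {y = y} x∈c x~y with em {P = y ∈ F}
  ... | yes y∈F = inj₂ (F-neighbour∈θ x∈c x~y y∈F)
  ... | no y∉F  = inj₁ (cell-closed x∈c x~y y∉F)

  -- Boundary vertices and the isomorphism with the reduced graph

  module _ (ψ : Vertex X → Vertex (reducedGraph X F))
           (selfSimilar : SelfSimilar X F ψ) (s1 : S1 X F) where
    open SelfSimilar selfSimilar
    open S1 s1
    open IsIsomorphism F3

    _≈F_ : Vertex (reducedGraph X F) → Vertex (reducedGraph X F) → Set ℓ
    _≈F_ = Graph._≈_ (reducedGraph X F)

    ψ⁻¹ : Vertex (reducedGraph X F) → Vertex X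
    ψ⁻¹ x = proj₁ (IsBijection.surjective isBijection x)

    ψ∘ψ⁻¹ : ∀ x → ψ (ψ⁻¹ x) ≈F x
    ψ∘ψ⁻¹ x = proj₂ (IsBijection.surjective isBijection x) ≈-refl

    ψ⁻¹-cong : ∀ {x y} → x ≈F y → ψ⁻¹ x ≈ ψ⁻¹ y
    ψ⁻¹-cong {x} {y} x≈y =
      IsBijection.injective isBijection (≈-trans (ψ∘ψ⁻¹ x) (≈-trans x≈y (≈-sym (ψ∘ψ⁻¹ y))))

    -- The proofs of membership in `F` are arbitrary, since vertices of the reduced graph are
    -- compared in `X` alone. Later walks can thus arrive with any such proofs.
    ψ⁻¹-edge : ∀ {c x y} (x∈θ : x ∈ θ X F c) (y∈θ : y ∈ θ X F c) → ¬ (x ≈ y) →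
               {x∈F : x ∈ F} {y∈F : y ∈ F} → ψ⁻¹ (x , x∈F) ~ ψ⁻¹ (y , y∈F)
    ψ⁻¹-edge {c} {x} {y} x∈θ y∈θ x≉y {x∈F} {y∈F} = Equivalence.from adjacency
      ( (λ eq → x≉y (≈-trans (≈-sym ψx) (≈-trans eq ψy)))
      , c , resp (θ X F c) (≈-sym ψx) x∈θ , resp (θ X F c) (≈-sym ψy) y∈θ )
      where
      ψx = ψ∘ψ⁻¹ (x , x∈F)
      ψy = ψ∘ψ⁻¹ (y , y∈F)

    boundary-triple⇒triangle : ∀ {c x y z} → x ∈ θ X F c → y ∈ θ X F c → z ∈ θ X F c →
      ¬ (x ≈ y) → ¬ (y ≈ z) → ¬ (x ≈ z) →
      ∃ λ u → ∃ λ v → ∃ λ w → u ~ v × v ~ w × u ~ w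
    boundary-triple⇒triangle x∈θ y∈θ z∈θ x≉y y≉z x≉z =
      ψ⁻¹ (_ , θ⊆F x∈θ) , ψ⁻¹ (_ , θ⊆F y∈θ) , ψ⁻¹ (_ , θ⊆F z∈θ) ,
      ψ⁻¹-edge x∈θ y∈θ x≉y , ψ⁻¹-edge y∈θ z∈θ y≉z , ψ⁻¹-edge x∈θ z∈θ x≉z

    edge : ∃ λ x → ∃ λ y → x ~ y
    edge = edge-exists em X connected infinite

    cell-exists : Vertex (outside X F)
    cell-exists with edge
    ... | x , y , x~y with em {P = x ∈ F}
    ...   | yes x∈F = y , λ y∈F → F1 x∈F y∈F x~y
    ...   | no x∉F  = x , x∉F

    module Transport (c d : Vertex (outside X F)) where
      α : Vertex (cellGraph X F c) → Vertex (cellGraph X F d)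
      α = proj₁ (cells-isomorphic c d)

      α-iso : IsIsomorphism (cellGraph X F c) (cellGraph X F d) α
      α-iso = proj₁ (proj₂ (cells-isomorphic c d))

      α-θ : ∀ {x} → proj₁ x ∈ θ X F c → proj₁ (α x) ∈ θ X F d
      α-θ {x} x∈θ = proj₁ (proj₂ (proj₂ (cells-isomorphic c d))) (x , x∈θ , ≈-refl)

      α-injective : ∀ {x y} → proj₁ (α x) ≈ proj₁ (α y) → proj₁ x ≈ proj₁ y
      α-injective = IsBijection.injective (IsIsomorphism.isBijection α-iso)

    -- The image under `ψ` of an edge of `X` is a pair of distinct vertices on the boundary of some
    -- cell `d`; the isomorphism of `S1` carries it to `c`.
    two-boundary-vertices : ∀ c → ∃ λ x → ∃ λ y → x ∈ θ X F c × y ∈ θ X F c × ¬ (x ≈ y)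
    two-boundary-vertices c with edge
    ... | x , y , x~y with Equivalence.to adjacency x~y
    ...   | ψx≉ψy , d , ψx∈θ , ψy∈θ =
      proj₁ (α (_ , inj₂ ψx∈θ)) , proj₁ (α (_ , inj₂ ψy∈θ)) ,
      α-θ ψx∈θ , α-θ ψy∈θ , λ eq → ψx≉ψy (α-injective eq)
      where open Transport d c

    bipartite⇒boundarySize-2 : Bipartite X → BoundarySize X F 2
    bipartite⇒boundarySize-2 bipartite c with two-boundary-vertices c
    ... | x , y , x∈θ , y∈θ , x≉y = record
      { to        = to
      ; cong      = λ { refl → ≈-refl }
      ; bijective = (λ { {zero}     {zero}     _  → refl
                       ; {zero}     {suc zero} eq → ⊥-elim (x≉y eq)
                       ; {suc zero} {zero}     eq → ⊥-elim (x≉y (≈-sym eq))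
                       ; {suc zero} {suc zero} _  → refl })
                  , covers
      }
      where
      to : Fin 2 → Σ (Vertex X) (Mem (θ X F c))
      to zero       = x , x∈θ
      to (suc zero) = y , y∈θ

      covers : ∀ z → ∃ λ i → ∀ {j} → j ≡ i → proj₁ (to j) ≈ proj₁ z
      covers (z , z∈θ) with em {P = x ≈ z} | em {P = y ≈ z}
      ... | yes x≈z | _       = zero , λ { refl → x≈z }
      ... | no _    | yes y≈z = suc zero , λ { refl → y≈z }
      -- A third boundary vertex would produce a triangle in `X`.
      ... | no x≉z  | no y≉z  with boundary-triple⇒triangle x∈θ y∈θ z∈θ x≉y y≉z x≉z
      ...   | _ , _ , _ , e , e′ , e″ = ⊥-elim (bipartite⇒no-triangle X bipartite e e′ e″)

    -- Colourings of the cell graphs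

    module _ (o : Vertex (outside X F)) (o-bipartite : Bipartite (cellGraph X F o)) where

      cellGraph-bipartite : ∀ c → Bipartite (cellGraph X F c)
      cellGraph-bipartite c =
        iso-bipartite (cellGraph X F c) (cellGraph X F o) α α-iso o-bipartite
        where open Transport c o

      colour : ∀ c {x} → x ∈ cell X F c ∪ θ X F c → Bool
      colour c x∈ = Func.to (proj₁ (cellGraph-bipartite c)) (_ , x∈)

      colour-cong : ∀ c {x y} (x∈ : x ∈ cell X F c ∪ θ X F c) (y∈ : y ∈ cell X F c ∪ θ X F c) →
                    x ≈ y → colour c x∈ ≡ colour c y∈
      colour-cong c x∈ y∈ x≈y =
        Func.cong (proj₁ (cellGraph-bipartite c)) {x = _ , x∈} {y = _ , y∈} x≈y

      colour-edge : ∀ c {x y} (x∈ : x ∈ cell X F c ∪ θ X F c) (y∈ : y ∈ cell X F c ∪ θ X F c) →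
                    x ~ y → colour c x∈ xor colour c y∈ ≡ true
      colour-edge c x∈ y∈ x~y =
        ≢⇒xor≡true (proj₂ (cellGraph-bipartite c) {x = _ , x∈} {y = _ , y∈} x~y)

      -- By `F1`, one of `x` and `y` lies outside `F`. All its neighbours lie in its cell graph,
      -- which therefore contains the whole triangle.
      no-triangle : ∀ {x y z} → x ~ y → y ~ z → x ~ z → ⊥
      no-triangle {x} {y} x~y y~z x~z with em {P = x ∈ F}
      ... | no x∉F = bipartite⇒no-triangle (cellGraph X F c) (cellGraph-bipartite c)
              {x = _ , inj₁ (self∈cell c)} {y = _ , neighbour∈cellGraph (self∈cell c) x~y}
              {z = _ , neighbour∈cellGraph (self∈cell c) x~z} x~y y~z x~z
        where c = x , x∉F
      ... | yes x∈F = bipartite⇒no-triangle (cellGraph X F c) (cellGraph-bipartite c)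
              {x = _ , neighbour∈cellGraph (self∈cell c) (~-sym x~y)} {y = _ , inj₁ (self∈cell c)}
              {z = _ , neighbour∈cellGraph (self∈cell c) y~z} x~y y~z x~z
        where c = y , λ y∈F → F1 x∈F y∈F x~y

      no-boundary-triple : ∀ {c x y z} → x ∈ θ X F c → y ∈ θ X F c → z ∈ θ X F c →
                           ¬ (x ≈ y) → ¬ (y ≈ z) → ¬ (x ≈ z) → ⊥
      no-boundary-triple x∈θ y∈θ z∈θ x≉y y≉z x≉z
        with boundary-triple⇒triangle x∈θ y∈θ z∈θ x≉y y≉z x≉z
      ... | _ , _ , _ , e , e′ , e″ = no-triangle e e′ e″

      -- It suffices to treat o: the other colourings are pulled back along the isomorphisms of S1.
      boundary-difference : ∃ λ p → ∀ c {x y} (x∈θ : x ∈ θ X F c) (y∈θ : y ∈ θ X F c) → ¬ (x ≈ y) →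
                            colour c (inj₂ x∈θ) xor colour c (inj₂ y∈θ) ≡ p
      boundary-difference = proj₁ at-o , λ c x∈θ y∈θ x≉y →
        let open Transport c o in
        proj₂ at-o (α (_ , inj₂ x∈θ)) (α (_ , inj₂ y∈θ)) (α-θ x∈θ) (α-θ y∈θ)
          (λ eq → x≉y (α-injective eq))
        where
        Vertexₒ : Set ℓ
        Vertexₒ = Vertex (cellGraph X F o)

        κ : Vertexₒ → Bool
        κ = Func.to (proj₁ o-bipartite)

        κ-separates : ∀ {x y : Vertexₒ} → κ x ≢ κ y → ¬ (proj₁ x ≈ proj₁ y)
        κ-separates {x} {y} κx≢κy x≈y = κx≢κy (Func.cong (proj₁ o-bipartite) {x = x} {y = y} x≈y)

        at-o : ∃ λ p → ∀ (x y : Vertexₒ) → proj₁ x ∈ θ X F o → proj₁ y ∈ θ X F o →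
               ¬ (proj₁ x ≈ proj₁ y) → κ x xor κ y ≡ p
        at-o with em {P = ∃ λ a → ∃ λ b → proj₁ a ∈ θ X F o × proj₁ b ∈ θ X F o × κ a ≢ κ b}
        ... | no monochromatic = false , equal
          where
          equal : ∀ (x y : Vertexₒ) → proj₁ x ∈ θ X F o → proj₁ y ∈ θ X F o →
                  ¬ (proj₁ x ≈ proj₁ y) → κ x xor κ y ≡ false
          equal x y x∈θ y∈θ _ with κ x ≟ᵇ κ y
          ... | yes eq = trans (cong (_xor κ y) eq) (xor-same (κ y))
          ... | no neq = ⊥-elim (monochromatic (x , y , x∈θ , y∈θ , neq))
        -- If distinct `x` and `y` had the same colour, then `a` or `b` would have the other one,
        -- and together with `x` and `y` it would form three distinct boundary vertices.
        ... | yes (a , b , a∈θ , b∈θ , κa≢κb) = true , λ x y x∈θ y∈θ x≉y →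
                ≢⇒xor≡true (distinct x y x∈θ y∈θ x≉y)
          where
          distinct : ∀ (x y : Vertexₒ) → proj₁ x ∈ θ X F o → proj₁ y ∈ θ X F o →
                     ¬ (proj₁ x ≈ proj₁ y) → κ x ≢ κ y
          distinct x y x∈θ y∈θ x≉y κx≡κy with κ x ≟ᵇ κ a
          ... | no κx≢κa = no-boundary-triple {o} x∈θ y∈θ a∈θ x≉y
                  (κ-separates {y} {a} λ eq → κx≢κa (trans κx≡κy eq)) (κ-separates {x} {a} κx≢κa)
          ... | yes κx≡κa = no-boundary-triple {o} x∈θ y∈θ b∈θ x≉y
                  (κ-separates {y} {b} λ eq → κx≢κb (trans κx≡κy eq)) (κ-separates {x} {b} κx≢κb)
            where
            κx≢κb : κ x ≢ κ b
            κx≢κb eq = κa≢κb (trans (sym κx≡κa) eq)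

      -- Reduction of walks between vertices of F

      p : Bool
      p = proj₁ boundary-difference

      -- Here `p ∧_` is multiplication by `p` modulo 2, and `n` stands for the length of the walk
      -- being reduced.
      Reduction : (x y : Vertex (reducedGraph X F)) → ℕ → Set ℓ
      Reduction x y n = Σ (Walk X (ψ⁻¹ x) (ψ⁻¹ y)) λ w →
                        2 * length X w ≤ n × parity n ≡ p ∧ parity (length X w)

      -- A segment of length `m` that returns to its first boundary vertex is even and is dropped.
      -- Otherwise it has parity `p` and becomes one edge, and `2 ≤ m` pays for that edge in the
      -- halving bound.
      prepend-segment : ∀ {c x y z} (x∈θ : x ∈ θ X F c) (y∈θ : y ∈ θ X F c)
        {x∈F : x ∈ F} {y∈F : y ∈ F} {m n} → 2 ≤ m →
        parity m ≡ colour c (inj₂ x∈θ) xor colour c (inj₂ y∈θ) →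
        Reduction (y , y∈F) z n → Reduction (x , x∈F) z (m + n)
      prepend-segment {c} {x} {y} x∈θ y∈θ {x∈F} {y∈F} {m} {n} 2≤m m-parity (w , bound , n-parity)
        with em {P = x ≈ y}
      ... | yes x≈y = Walk-respˡ X ψ⁻¹x≈ψ⁻¹y w ,
              subst (λ k → 2 * k ≤ m + n × parity (m + n) ≡ p ∧ parity k)
                (sym (length-respˡ X ψ⁻¹x≈ψ⁻¹y w))
                ( ≤-trans bound (m≤n+m n m)
                , trans (parity-+ m n) (cong₂ _xor_ m-even n-parity) )
        where
        ψ⁻¹x≈ψ⁻¹y : ψ⁻¹ (x , x∈F) ≈ ψ⁻¹ (y , y∈F)
        ψ⁻¹x≈ψ⁻¹y = ψ⁻¹-cong x≈y

        m-even : parity m ≡ false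
        m-even = trans m-parity (trans
          (cong (_xor colour c (inj₂ y∈θ)) (colour-cong c (inj₂ x∈θ) (inj₂ y∈θ) x≈y))
          (xor-same (colour c (inj₂ y∈θ))))
      ... | no x≉y = ψ⁻¹-edge x∈θ y∈θ x≉y ∷ w
              , ≤-trans (≤-reflexive (*-suc 2 (length X w))) (+-mono-≤ 2≤m bound)
              , trans (parity-+ m n) (trans
                  (cong₂ _xor_ (trans m-parity (proj₂ boundary-difference c x∈θ y∈θ x≉y)) n-parity)
                  (xor-∧-not p (parity (length X w))))

      -- An edge inside a cell graph flips the colour, so colour differences along a walk telescope.
      parity-step : ∀ c {x y z} (x∈ : x ∈ cell X F c ∪ θ X F c) (y∈ : y ∈ cell X F c ∪ θ X F c)
        (z∈ : z ∈ cell X F c ∪ θ X F c) {n} → x ~ y → parity n ≡ colour c y∈ xor colour c z∈ →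
        parity (suc n) ≡ colour c x∈ xor colour c z∈
      parity-step c x∈ y∈ z∈ {n} x~y n-parity = begin
        true xor parity n
          ≡⟨ cong₂ _xor_ (sym (colour-edge c x∈ y∈ x~y)) n-parity ⟩
        (colour c x∈ xor colour c y∈) xor (colour c y∈ xor colour c z∈)
          ≡⟨ xor-telescope (colour c x∈) (colour c y∈) (colour c z∈) ⟩
        colour c x∈ xor colour c z∈ ∎
        where open ≡-Reasoning

      -- The walk is cut at its first vertex `z` in `F`. The part before `z` starts outside `F`, so
      -- its length has the form `suc m`; `l` is the length of the rest.
      FirstExit : ∀ c {x} → x ∈ cell X F c → Vertex (reducedGraph X F) → ℕ → Set ℓ
      FirstExit c x∈c y n = ∃ λ z → Σ (z ∈ θ X F c) λ z∈θ → ∃ λ m → ∃ λ l →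
        suc m + l ≡ n ×
        parity (suc m) ≡ colour c (inj₁ x∈c) xor colour c (inj₂ z∈θ) ×
        Reduction (z , θ⊆F z∈θ) y l

      mutual
        -- By `F1` the first edge enters a cell. The walk is followed to its next vertex in `F`,
        -- where the reduction starts again on a shorter walk.
        reduce : ∀ {x y} (x∈F : x ∈ F) (y∈F : y ∈ F) (w : Walk X x y) →
                 Reduction (x , x∈F) (y , y∈F) (length X w)
        reduce x∈F y∈F [ x≈y ] = [ ψ⁻¹-cong x≈y ] , z≤n , sym (∧-zeroʳ p)
        reduce {x} x∈F y∈F (_∷_ {y = u} x~u w)
          with reduce-from-cell (u , λ u∈F → F1 x∈F u∈F x~u) (self∈cell _) y∈F w
        ... | z , z∈θ , m , l , length-eq , m-parity , r =
          subst (Reduction _ _) (cong suc length-eq)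
            -- The edge into the cell and the `suc m` edges up to `z` make the segment at least 2
            -- long.
            (prepend-segment x∈θ z∈θ (s≤s (s≤s z≤n))
              (parity-step c (inj₂ x∈θ) (inj₁ (self∈cell c)) (inj₂ z∈θ) {suc m} x~u m-parity) r)
          where
          c : Vertex (outside X F)
          c = u , λ u∈F → F1 x∈F u∈F x~u

          x∈θ : x ∈ θ X F c
          x∈θ = F-neighbour∈θ (self∈cell c) (~-sym x~u) x∈F

        reduce-from-cell : ∀ c {x y} (x∈c : x ∈ cell X F c) (y∈F : y ∈ F) (w : Walk X x y) →
                           FirstExit c x∈c (y , y∈F) (length X w)
        reduce-from-cell c x∈c y∈F [ x≈y ] = ⊥-elim (proj₁ (resp (cell X F c) x≈y x∈c) y∈F)
        reduce-from-cell c x∈c y∈F (_∷_ {y = u} x~u w) with em {P = u ∈ F}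
        ... | yes u∈F = u , u∈θ , 0 , length X w , refl
                      , sym (colour-edge c (inj₁ x∈c) (inj₂ u∈θ) x~u)
                      , reduce (θ⊆F u∈θ) y∈F w
          where
          u∈θ : u ∈ θ X F c
          u∈θ = F-neighbour∈θ x∈c x~u u∈F
        ... | no u∉F with reduce-from-cell c (cell-closed x∈c x~u u∉F) y∈F w
        ...   | z , z∈θ , m , l , eq , m-parity , r =
          z , z∈θ , suc m , l , cong suc eq ,
          parity-step c (inj₁ x∈c) (inj₁ (cell-closed x∈c x~u u∉F)) (inj₂ z∈θ) {suc m} x~u m-parity , r

      -- Descent on closed walks

      StaysInCell : ∀ c {x} → x ∈ cell X F c → Vertex X → ℕ → Set ℓ
      StaysInCell c x∈c y n = Σ (y ∈ cell X F c) λ y∈c →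
        parity n ≡ colour c (inj₁ x∈c) xor colour c (inj₁ y∈c)

      MeetsF : Vertex X → Vertex X → ℕ → Set ℓ
      MeetsF x y n = ∃ λ z → z ∈ F × Σ (Walk X x z) λ w₁ → Σ (Walk X z y) λ w₂ →
        length X w₁ + length X w₂ ≡ n

      -- A walk cannot leave its cell without meeting `F`. While it stays inside, its parity is the
      -- colour difference of its ends.
      stays-or-meets-F : ∀ c {x y} (x∈c : x ∈ cell X F c) (w : Walk X x y) →
                         StaysInCell c x∈c y (length X w) ⊎ MeetsF x y (length X w)
      stays-or-meets-F c {x} {y} x∈c [ x≈y ] = inj₁ (y∈c , sym (trans
          (cong (_xor colour c (inj₁ y∈c)) (colour-cong c (inj₁ x∈c) (inj₁ y∈c) x≈y))
          (xor-same (colour c (inj₁ y∈c)))))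
        where
        y∈c : y ∈ cell X F c
        y∈c = resp (cell X F c) x≈y x∈c
      stays-or-meets-F c x∈c (_∷_ {y = u} x~u w) with em {P = u ∈ F}
      ... | yes u∈F = inj₂ (u , u∈F , x~u ∷ [ ≈-refl ] , w , refl)
      ... | no u∉F with stays-or-meets-F c (cell-closed x∈c x~u u∉F) w
      ...   | inj₂ (z , z∈F , w₁ , w₂ , eq) = inj₂ (z , z∈F , x~u ∷ w₁ , w₂ , cong suc eq)
      ...   | inj₁ (y∈c , w-parity) = inj₁ (y∈c ,
                parity-step c (inj₁ x∈c) (inj₁ (cell-closed x∈c x~u u∉F)) (inj₁ y∈c)
                  {length X w} x~u w-parity)

      EvenClosedWalksOfLength : ℕ → Set ℓ
      EvenClosedWalksOfLength n = ∀ {x} (w : Walk X x x) → length X w ≡ n → parity n ≡ false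

      even-through-F : ∀ n → (∀ {m} → m < n → EvenClosedWalksOfLength m) →
                       ∀ {x} → x ∈ F → (w : Walk X x x) → length X w ≡ n → parity n ≡ false
      even-through-F zero    _       _   _ _  = refl
      even-through-F (suc n) shorter x∈F w eq with subst (Reduction _ _) eq (reduce x∈F x∈F w)
      ... | w′ , bound , n-parity = trans n-parity (trans
              -- The reduced walk is again closed and strictly shorter, hence even, and `p` times an
              -- even length is even.
              (cong (p ∧_) (shorter (s≤s (2*k≤1+n⇒k≤n (length X w′) bound)) w′ refl))
              (∧-zeroʳ p))

      even-of-length : ∀ n → EvenClosedWalksOfLength n
      even-of-length = <-rec EvenClosedWalksOfLength step
        where
        step : ∀ n → (∀ {m} → m < n → EvenClosedWalksOfLength m) → EvenClosedWalksOfLength n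
        step n shorter {x} w eq with em {P = x ∈ F}
        ... | yes x∈F = even-through-F n shorter x∈F w eq
        ... | no x∉F with stays-or-meets-F (x , x∉F) (self∈cell _) w
        -- Both ends are `x`, with possibly different membership proofs; `colour-cong` gives them
        -- the same colour.
        ...   | inj₁ (x∈c , w-parity) = trans (cong parity (sym eq)) (trans w-parity
                  (trans (cong (_xor colour c (inj₁ x∈c))
                           (colour-cong c (inj₁ (self∈cell c)) (inj₁ x∈c) ≈-refl))
                         (xor-same (colour c (inj₁ x∈c)))))
          where
          c : Vertex (outside X F)
          c = x , x∉F
        ...   | inj₂ (z , z∈F , w₁ , w₂ , eq′) =
                  -- The closed walk is rotated so that it starts and ends at `z` in `F`.
                  even-through-F n shorter z∈F (_++_ X w₂ w₁)
                    (trans (length-++ X w₂ w₁)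
                      (trans (+-comm (length X w₂) (length X w₁)) (trans eq′ eq)))

      cellGraph-bipartite⇒bipartite : Bipartite X
      cellGraph-bipartite⇒bipartite =
        evenClosedWalks⇒bipartite X connected (proj₁ o) (λ w → even-of-length (length X w) w refl)

lemma2 : {ℓ : Level} → ExcludedMiddle ℓ →
    (X : Graph ℓ) (F : VertexSet X) (ψ : Vertex X → Vertex (reducedGraph X F)) →
    SelfSimilar X F ψ → S1 X F →
    (Bipartite X ⇔ (∃ λ c → Bipartite (cellGraph X F c))) ×
    (Bipartite X → BoundarySize X F 2)
lemma2 em X F ψ selfSimilar s1 =
  mk⇔ (λ bipartite → c₀ , spanned-bipartite X (cell X F c₀ ∪ θ X F c₀) bipartite)
      (λ { (c , bipartite) → cellGraph-bipartite⇒bipartite em X F ψ selfSimilar s1 c bipartite }) ,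
  bipartite⇒boundarySize-2 em X F ψ selfSimilar s1
  where
  c₀ : Vertex (outside X F)
  c₀ = cell-exists em X F ψ selfSimilar s1
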